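{- For each of the thirteen axioms $$Ax\in\{(\mathrm{ciw}),(\mathrm{ci}),(\mathrm{cl}),(\mathrm{cf}),(d1),(d2),(i1),(i2),(\mathrm{a}_\circ),(\mathrm{a}_\neg),(\mathrm{ca}_\wedge),(\mathrm{ca}_\vee),(\mathrm{ca}_\to)\},$$ the logic $\mathrm{RmbC}(Ax)$ is decidable, i.e. its set of theorems is recursive.
   Context: Formulas are built from a countably infinite set of propositional variables $\{p_n:n\in\mathbb{N}\}$ using binary $\wedge,\vee,\to$ and unary $\neg,\circ$; $\alpha\leftrightarrow\beta$ abbreviates $(\alpha\to\beta)\wedge(\beta\to\alpha)$. The logic $\mathrm{RmbC}$ is given by the Hilbert calculus with axiom schemas $\alpha\to(\beta\to\alpha)$; $(\alpha\to(\beta\to\gamma))\to((\alpha\to\beta)\to(\alpha\to\gamma))$; $\alpha\to(\beta\to(\alpha\wedge\beta))$; $(\alpha\wedge\beta)\to\alpha$; $(\alpha\wedge\beta)\to\beta$; $\alpha\to(\alpha\vee\beta)$; $\beta\to(\alpha\vee\beta)$; $(\alpha\to\gamma)\to((\beta\to\gamma)\to((\alpha\vee\beta)\to\gamma))$; $(\alpha\to\beta)\vee\alpha$; $\alpha\vee\neg\alpha$; $\circ\alpha\to(\alpha\to(\neg\alpha\to\beta))$; and inference rules: modus ponens; $(R_\neg)$: from $\alpha\leftrightarrow\psi$ infer $\neg\alpha\leftrightarrow\neg\psi$; $(R_\circ)$: from $\alpha\leftrightarrow\psi$ infer $\circ\alpha\leftrightarrow\circ\psi$. $\mathrm{RmbC}(Ax)$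 is obtained by adding the axiom schema $Ax$ to this calculus; its theorems are the formulas derivable in it (without premises). The schemas are: - $(\mathrm{ciw})$: $\circ\alpha\vee(\alpha\wedge\neg\alpha)$; - $(\mathrm{ci})$: $\neg{\circ}\alpha\to(\alpha\wedge\neg\alpha)$; - $(\mathrm{cl})$: $\neg(\alpha\wedge\neg\alpha)\to\circ\alpha$; - $(\mathrm{cf})$: $\neg\neg\alpha\to\alpha$; - $(d1)$: $\circ\alpha\vee\alpha$; - $(d2)$: $\circ\alpha\vee\neg\alpha$; - $(i1)$: $\neg{\circ}\alpha\to\alpha$; - $(i2)$: $\neg{\circ}\alpha\to\neg\alpha$; - $(\mathrm{a}_\circ)$: $\circ{\circ}\alpha$; - $(\mathrm{a}_\neg)$: $\circ\alpha\to\circ\neg\alpha$; - $(\mathrm{ca}_\#)$, for $\#\in\{\wedge,\vee,\to\}$: $(\circ\alpha\wedge\circ\beta)\to\circ(\alpha\#\beta)$. -}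

module Defs where

open import Data.Nat using (ℕ)
open import Level using (0ℓ)
open import Relation.Unary using (Pred)

infix  30 ¬'_ ∘'_
infixr 25 _∧'_
infixr 24 _∨'_
infixr 23 _⇒_
infix  22 _⇔'_

data Formula : Set where
  var            : ℕ → Formula
  _∧'_ _∨'_ _⇒_  : Formula → Formula → Formula
  ¬'_ ∘'_        : Formula → Formula

_⇔'_ : Formula → Formula → Formula
α ⇔' β = (α ⇒ β) ∧' (β ⇒ α)

data Schema : Set where
  ciw ci cl cf d1 d2 i1 i2 a∘ a¬ ca∧ ca∨ ca⇒ : Schema

data Instance : Schema → Pred Formula 0ℓ where
  ciw : ∀ α   → Instance ciw (∘' α ∨' (α ∧' ¬' α))
  ci  : ∀ α   → Instance ci  (¬' (∘' α) ⇒ (α ∧' ¬' α))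
  cl  : ∀ α   → Instance cl  (¬' (α ∧' ¬' α) ⇒ ∘' α)
  cf  : ∀ α   → Instance cf  (¬' (¬' α) ⇒ α)
  d1  : ∀ α   → Instance d1  (∘' α ∨' α)
  d2  : ∀ α   → Instance d2  (∘' α ∨' ¬' α)
  i1  : ∀ α   → Instance i1  (¬' (∘' α) ⇒ α)
  i2  : ∀ α   → Instance i2  (¬' (∘' α) ⇒ ¬' α)
  a∘  : ∀ α   → Instance a∘  (∘' (∘' α))
  a¬  : ∀ α   → Instance a¬  (∘' α ⇒ ∘' (¬' α))
  ca∧ : ∀ α β → Instance ca∧ ((∘' α ∧' ∘' β) ⇒ ∘' (α ∧' β))
  ca∨ : ∀ α β → Instance ca∨ ((∘' α ∧' ∘' β) ⇒ ∘' (α ∨' β))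
  ca⇒ : ∀ α β → Instance ca⇒ ((∘' α ∧' ∘' β) ⇒ ∘' (α ⇒ β))

-- Derivability without premises, so the rules R¬ and R∘ apply to theorems only.
-- Recursiveness of this set of formulas is Relation.Unary.Decidable: there is no
-- excluded middle or choice here, so a closed decider is a terminating program.
data RmbC (Ax : Schema) : Pred Formula 0ℓ where
  K     : ∀ α β   → RmbC Ax (α ⇒ (β ⇒ α))
  S     : ∀ α β γ → RmbC Ax ((α ⇒ (β ⇒ γ)) ⇒ ((α ⇒ β) ⇒ (α ⇒ γ)))
  ∧I    : ∀ α β   → RmbC Ax (α ⇒ (β ⇒ (α ∧' β)))
  ∧E₁   : ∀ α β   → RmbC Ax ((α ∧' β) ⇒ α)
  ∧E₂   : ∀ α β   → RmbC Ax ((α ∧' β) ⇒ β)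
  ∨I₁   : ∀ α β   → RmbC Ax (α ⇒ (α ∨' β))
  ∨I₂   : ∀ α β   → RmbC Ax (β ⇒ (α ∨' β))
  ∨E    : ∀ α β γ → RmbC Ax ((α ⇒ γ) ⇒ ((β ⇒ γ) ⇒ ((α ∨' β) ⇒ γ)))
  ⇒∨    : ∀ α β   → RmbC Ax ((α ⇒ β) ∨' α)
  em    : ∀ α     → RmbC Ax (α ∨' ¬' α)
  bc    : ∀ α β   → RmbC Ax (∘' α ⇒ (α ⇒ (¬' α ⇒ β)))
  extra : ∀ {α}   → Instance Ax α → RmbC Ax α
  MP    : ∀ {α β} → RmbC Ax α → RmbC Ax (α ⇒ β) → RmbC Ax β
  R¬    : ∀ {α ψ} → RmbC Ax (α ⇔' ψ) → RmbC Ax (¬' α ⇔' ¬' ψ)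
  R∘    : ∀ {α ψ} → RmbC Ax (α ⇔' ψ) → RmbC Ax (∘' α ⇔' ∘' ψ)

{-# OPTIONS --safe #-}

-- A congruential form of filtration, made constructive by elimination of worlds. Treat variables and
-- formulas ¬α, ∘α as propositional atoms and start from all valuations ("worlds") of finitely many atoms;
-- everything true in all of them is derivable. As long as this holds for the remaining worlds W,
-- ‖α‖ = ‖β‖ on W makes α ⇔ β, hence ¬α ⇔ ¬β and ∘α ⇔ ∘β, derivable, so worlds refuting these (or similar
-- consequences of the axiom) may be deleted. At the fixed point ‖α‖ ↦ ‖¬α‖ and ‖α‖ ↦ ‖∘α‖ are well defined
-- on the sets named by a finite list of formulas; they extend to all of P(W) so that the axiom is valid,
-- and φ is derivable iff it is true in all of W. The named sets form a Boolean algebra, so a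
-- set without a name has a complement without a name, which is what makes the extension possible.
module Submission where

open import Data.Bool using (Bool; true; false; not; _∧_; _∨_; if_then_else_)
import Data.Bool.Properties as Bool
open import Data.List
  using (List; []; _∷_; _++_; map; concatMap; cartesianProduct; cartesianProductWith; filter; length)
open import Data.List.Properties using (filter-notAll)
open import Data.List.Membership.Propositional using (_∈_; find; lose)
open import Data.List.Membership.Propositional.Properties
open import Data.List.Relation.Binary.Subset.Propositional using (_⊆_)
open import Data.List.Relation.Binary.Subset.Propositional.Properties using (xs⊆xs++ys; xs⊆ys++xs)
open import Data.List.Relation.Unary.All as All using (All; []; _∷_)
import Data.List.Relation.Unary.All.Properties as All
open import Data.List.Relation.Unary.Any as Any using (Any; here; there)
import Data.Nat as ℕ
open import Data.Nat.Induction using (Acc; acc; <-wellFounded)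
open import Data.Product using (∃-syntax; _×_; _,_; proj₁; proj₂; uncurry)
open import Data.Sum using (_⊎_; inj₁; inj₂; [_,_]′)
open import Function using (_∘_; const; id)
open import Relation.Binary.Definitions using (DecidableEquality)
open import Relation.Binary.PropositionalEquality using (_≡_; refl; sym; trans; cong; cong₂; subst)
open import Relation.Nullary using (Dec; yes; no; ¬_; contradiction)
open import Relation.Nullary.Decidable using (map′; _×-dec_; _→-dec_)
open import Relation.Unary using (Decidable)

open import Defs

-- Decidable equality of formulas.

_≟_ : DecidableEquality Formula
var m ≟ var n = map′ (cong var) (λ { refl → refl }) (m ℕ.≟ n)
(α ∧' β) ≟ (γ ∧' δ) = map′ (uncurry (cong₂ _∧'_)) (λ { refl → refl , refl }) (α ≟ γ ×-dec β ≟ δ)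
(α ∨' β) ≟ (γ ∨' δ) = map′ (uncurry (cong₂ _∨'_)) (λ { refl → refl , refl }) (α ≟ γ ×-dec β ≟ δ)
(α ⇒ β) ≟ (γ ⇒ δ) = map′ (uncurry (cong₂ _⇒_)) (λ { refl → refl , refl }) (α ≟ γ ×-dec β ≟ δ)
(¬' α) ≟ (¬' β) = map′ (cong ¬'_) (λ { refl → refl }) (α ≟ β)
(∘' α) ≟ (∘' β) = map′ (cong ∘'_) (λ { refl → refl }) (α ≟ β)
(var _) ≟ (_ ∧' _) = no λ ()
(var _) ≟ (_ ∨' _) = no λ ()
(var _) ≟ (_ ⇒ _) = no λ ()
(var _) ≟ (¬' _) = no λ ()
(var _) ≟ (∘' _) = no λ ()
(_ ∧' _) ≟ (var _) = no λ ()
(_ ∧' _) ≟ (_ ∨' _) = no λ ()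
(_ ∧' _) ≟ (_ ⇒ _) = no λ ()
(_ ∧' _) ≟ (¬' _) = no λ ()
(_ ∧' _) ≟ (∘' _) = no λ ()
(_ ∨' _) ≟ (var _) = no λ ()
(_ ∨' _) ≟ (_ ∧' _) = no λ ()
(_ ∨' _) ≟ (_ ⇒ _) = no λ ()
(_ ∨' _) ≟ (¬' _) = no λ ()
(_ ∨' _) ≟ (∘' _) = no λ ()
(_ ⇒ _) ≟ (var _) = no λ ()
(_ ⇒ _) ≟ (_ ∧' _) = no λ ()
(_ ⇒ _) ≟ (_ ∨' _) = no λ ()
(_ ⇒ _) ≟ (¬' _) = no λ ()
(_ ⇒ _) ≟ (∘' _) = no λ ()
(¬' _) ≟ (var _) = no λ ()
(¬' _) ≟ (_ ∧' _) = no λ ()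
(¬' _) ≟ (_ ∨' _) = no λ ()
(¬' _) ≟ (_ ⇒ _) = no λ ()
(¬' _) ≟ (∘' _) = no λ ()
(∘' _) ≟ (var _) = no λ ()
(∘' _) ≟ (_ ∧' _) = no λ ()
(∘' _) ≟ (_ ∨' _) = no λ ()
(∘' _) ≟ (_ ⇒ _) = no λ ()
(∘' _) ≟ (¬' _) = no λ ()

-- Worlds and truncated valuations.

infix 31 ∼_

-- The language has no primitive falsum. By `bc` this formula implies everything, so `∼_` is a
-- classical negation, in contrast to `¬'_`.
p ⊥' : Formula
p  = var 0
⊥' = p ∧' (¬' p ∧' ∘' p)

∼_ : Formula → Formula
∼ α = α ⇒ ⊥'

World : Set
World = List (Formula × Bool)

bit : World → Formula → Bool
bit []            γ = false
bit ((α , b) ∷ w) γ with α ≟ γ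
... | yes _ = b
... | no  _ = bit w γ

-- Truncating the bits of ¬α and ∘α makes every world satisfy the schemas em and bc.
eval : World → Formula → Bool
eval w (var n)  = bit w (var n)
eval w (α ∧' β) = eval w α ∧ eval w β
eval w (α ∨' β) = eval w α ∨ eval w β
eval w (α ⇒ β)  = not (eval w α) ∨ eval w β
eval w (¬' α)   = not (eval w α) ∨ bit w (¬' α)
eval w (∘' α)   = not (eval w α ∧ bit w (¬' α)) ∧ bit w (∘' α)

atoms : Formula → List Formula
atoms (var n)  = var n ∷ []
atoms (α ∧' β) = atoms α ++ atoms β
atoms (α ∨' β) = atoms α ++ atoms β
atoms (α ⇒ β)  = atoms α ++ atoms β
atoms (¬' α)   = ¬' α ∷ atoms α
-- `¬' α` is listed because `eval` consults its bit when truncating `∘' α`.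
atoms (∘' α)   = ∘' α ∷ ¬' α ∷ atoms α

infix 4 _⊨_

_⊨_ : List World → Formula → Set
W ⊨ γ = All (λ w → eval w γ ≡ true) W

_⊨?_ : ∀ W γ → Dec (W ⊨ γ)
W ⊨? γ = All.all? (λ w → eval w γ Bool.≟ true) W

imp-intro : ∀ {x y} → (x ≡ true → y ≡ true) → not x ∨ y ≡ true
imp-intro {false} _ = refl
imp-intro {true}  f = f refl

imp-elim : ∀ {x y} → x ≡ true → not x ∨ y ≡ true → y ≡ true
imp-elim refl e = e

iff-intro : ∀ {x y} → x ≡ y → (not x ∨ y) ∧ (not y ∨ x) ≡ true
iff-intro {false} refl = refl
iff-intro {true}  refl = refl

iff-elim : ∀ {x y} → (not x ∨ y) ∧ (not y ∨ x) ≡ true → x ≡ y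
iff-elim {false} {false} _ = refl
iff-elim {true}  {true}  _ = refl

allBool : (Bool → Bool) → Bool
allBool f = f true ∧ f false

allBool-elim : ∀ f → allBool f ≡ true → ∀ b → f b ≡ true
allBool-elim f t true  = Bool.∧-conicalˡ (f true) (f false) t
allBool-elim f t false = Bool.∧-conicalʳ (f true) (f false) t

-- If `p` and `¬' p` are both true at `w`, truncation makes `∘' p` false there.
eval-⊥' : ∀ w → eval w ⊥' ≡ false
eval-⊥' w with eval w p | bit w (¬' p)
... | false | _     = refl
... | true  | false = refl
... | true  | true  = refl

worlds : List Formula → List World
worlds []      = [] ∷ []
worlds (α ∷ A) = map ((α , true) ∷_) (worlds A) ++ map ((α , false) ∷_) (worlds A)

keys : World → List Formula
keys = map proj₁

keys-worlds : ∀ A → All (λ w → keys w ≡ A) (worlds A)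
keys-worlds []      = refl ∷ []
keys-worlds (α ∷ A) = All.++⁺ (All.map⁺ ih) (All.map⁺ ih)
  where ih = All.map (cong (α ∷_)) (keys-worlds A)

lit : Formula → Bool → Formula
lit α true  = α
lit α false = ∼ α

literals : World → List Formula
literals = map (uncurry lit)

lit-bit∈literals : ∀ w {α} → α ∈ keys w → lit α (bit w α) ∈ literals w
lit-bit∈literals ((β , b) ∷ w) {α} i with β ≟ α
... | yes refl = here refl
lit-bit∈literals ((β , b) ∷ w) (here refl) | no β≢β = contradiction refl β≢β
lit-bit∈literals ((β , b) ∷ w) (there i)   | no _   = there (lit-bit∈literals w i)

-- Derivability from hypotheses and completeness for all valuations.

module Derivability (Ax : Schema) where

  infix 4 _⊢_

  -- Hypotheses are combined by modus ponens alone; `R¬` and `R∘` occur only inside `thm`. This is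
  -- what makes the deduction theorem hold.
  data _⊢_ (Δ : List Formula) : Formula → Set where
    hyp : ∀ {α} → α ∈ Δ → Δ ⊢ α
    thm : ∀ {α} → RmbC Ax α → Δ ⊢ α
    mp  : ∀ {α β} → Δ ⊢ α → Δ ⊢ α ⇒ β → Δ ⊢ β

  weaken : ∀ {Δ α β} → Δ ⊢ β → α ∷ Δ ⊢ β
  weaken (hyp i)  = hyp (there i)
  weaken (thm t)  = thm t
  weaken (mp d e) = mp (weaken d) (weaken e)

  deduction : ∀ {Δ α β} → α ∷ Δ ⊢ β → Δ ⊢ α ⇒ β
  deduction {α = α} (hyp (here refl)) = mp (thm (K α α)) (mp (thm (K α (α ⇒ α))) (thm (S α (α ⇒ α) α)))
  deduction (hyp (there i)) = mp (hyp i) (thm (K _ _))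
  deduction (thm t)         = mp (thm t) (thm (K _ _))
  deduction (mp d e)        = mp (deduction d) (mp (deduction e) (thm (S _ _ _)))

  theorem : ∀ {α} → [] ⊢ α → RmbC Ax α
  theorem (thm t)  = t
  theorem (mp d e) = MP (theorem d) (theorem e)

  hyp₀ : ∀ {Δ α} → α ∷ Δ ⊢ α
  hyp₀ = hyp (here refl)

  explosion : ∀ {Δ β} → Δ ⊢ ⊥' → Δ ⊢ β
  explosion d =
    mp (mp r (thm (∧E₁ _ _))) (mp (mp d (thm (∧E₁ _ _))) (mp (mp r (thm (∧E₂ _ _))) (thm (bc p _))))
    where r = mp d (thm (∧E₂ p (¬' p ∧' ∘' p)))

  ∨-elim : ∀ {Δ α β γ} → Δ ⊢ α ∨' β → α ∷ Δ ⊢ γ → β ∷ Δ ⊢ γ → Δ ⊢ γ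
  ∨-elim d e f = mp d (mp (deduction f) (mp (deduction e) (thm (∨E _ _ _))))

  -- The axiom `⇒∨` with `⊥'` as its second formula is excluded middle for `∼_`.
  by-cases : ∀ {Δ} α {γ} → Δ ⊢ α ⇒ γ → Δ ⊢ ∼ α ⇒ γ → Δ ⊢ γ
  by-cases α d e = ∨-elim (thm (⇒∨ α ⊥')) (mp hyp₀ (weaken e)) (mp hyp₀ (weaken d))

  -- Kalmár's lemma, with `∼_` expressing falsity. Among atoms, only `¬' α` at a false `α`, and
  -- `∘' α` where `α` and `¬' α` are true, take a value not read from their own bit; there `em` and
  -- `bc` supply the derivation, so truncation adds nothing underivable.
  kalmár : ∀ w γ → atoms γ ⊆ keys w → literals w ⊢ lit γ (eval w γ)
  kalmár w (var n)  s = hyp (lit-bit∈literals w (s (here refl)))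
  kalmár w (α ∧' β) s
    with eval w α | kalmár w α (s ∘ ∈-++⁺ˡ) | eval w β | kalmár w β (s ∘ ∈-++⁺ʳ _)
  ... | false | d | _     | e = deduction (mp (mp hyp₀ (thm (∧E₁ _ _))) (weaken d))
  ... | true  | d | false | e = deduction (mp (mp hyp₀ (thm (∧E₂ _ _))) (weaken e))
  ... | true  | d | true  | e = mp e (mp d (thm (∧I _ _)))
  kalmár w (α ∨' β) s
    with eval w α | kalmár w α (s ∘ ∈-++⁺ˡ) | eval w β | kalmár w β (s ∘ ∈-++⁺ʳ _)
  ... | true  | d | _     | e = mp d (thm (∨I₁ _ _))
  ... | false | d | true  | e = mp e (thm (∨I₂ _ _))
  ... | false | d | false | e = mp e (mp d (thm (∨E _ _ _)))
  kalmár w (α ⇒ β) s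
    with eval w α | kalmár w α (s ∘ ∈-++⁺ˡ) | eval w β | kalmár w β (s ∘ ∈-++⁺ʳ _)
  ... | false | d | _     | e = deduction (explosion (mp hyp₀ (weaken d)))
  ... | true  | d | true  | e = mp e (thm (K _ _))
  ... | true  | d | false | e = deduction (mp (mp (weaken d) hyp₀) (weaken e))
  kalmár w (¬' α) s with eval w α | kalmár w α (s ∘ there)
  ... | true  | d = hyp (lit-bit∈literals w (s (here refl)))
  ... | false | d = ∨-elim (thm (em α)) (explosion (mp hyp₀ (weaken d))) hyp₀
  kalmár w (∘' α) s
    with eval w α | kalmár w α (s ∘ there ∘ there)
       | bit w (¬' α) | lit-bit∈literals w (s (there (here refl)))
  ... | false | _ | _     | _ = hyp (lit-bit∈literals w (s (here refl)))
  ... | true  | _ | false | _ = hyp (lit-bit∈literals w (s (here refl)))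
  ... | true  | d | true  | i = deduction (mp (hyp (there i)) (mp (weaken d) (mp hyp₀ (thm (bc α ⊥')))))

  -- Every assignment to the remaining atoms occurs with both values of the first one, so the atoms
  -- are removed one at a time by cases.
  discharge : ∀ A {γ} → All (λ w → literals w ⊢ γ) (worlds A) → [] ⊢ γ
  discharge []      (d ∷ []) = d
  discharge (α ∷ A) ds =
    discharge A (All.zipWith (λ (d , e) → by-cases α (deduction d) (deduction e)) (All.map⁻ ds⁺ , All.map⁻ ds⁻))
    where
    ds⁺ = All.++⁻ˡ (map ((α , true) ∷_) (worlds A)) ds
    ds⁻ = All.++⁻ʳ (map ((α , true) ∷_) (worlds A)) ds

  completeness : ∀ A γ → atoms γ ⊆ A → worlds A ⊨ γ → RmbC Ax γ
  completeness A γ s v = theorem (discharge A (All.zipWith step (keys-worlds A , v)))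
    where
    step : ∀ {w} → keys w ≡ A × eval w γ ≡ true → literals w ⊢ γ
    step {w} (refl , e) = subst (λ b → literals w ⊢ lit γ b) e (kalmár w γ s)

  ⇒-trans : ∀ {α β γ} → RmbC Ax (α ⇒ β) → RmbC Ax (β ⇒ γ) → RmbC Ax (α ⇒ γ)
  ⇒-trans d e = MP d (MP (MP e (K _ _)) (S _ _ _))

  ⇔-to : ∀ {α β} → RmbC Ax (α ⇔' β) → RmbC Ax (α ⇒ β)
  ⇔-to d = MP d (∧E₁ _ _)

  ⇔-from : ∀ {α β} → RmbC Ax (α ⇔' β) → RmbC Ax (β ⇒ α)
  ⇔-from d = MP d (∧E₂ _ _)

  em-elim : ∀ {α γ} → RmbC Ax (α ⇒ γ) → RmbC Ax (¬' α ⇒ γ) → RmbC Ax γ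
  em-elim d e = MP (em _) (MP e (MP d (∨E _ _ _)))

-- Admissible rules that drive the elimination.

Rule : Set
Rule = Formula × Formula

-- Substituting γ for an equivalent compound subformula keeps the conclusions within
-- the finitely many formulas ¬α, ∘α for α in the fixed finite list of formulas.
axiomRules : Schema → Formula → Formula → Formula → List Rule
axiomRules ciw α β γ = (α ⇒ α , ∘' α ∨' (α ∧' ¬' α)) ∷ []
axiomRules ci  α β γ = (γ ⇔' ∘' α , ¬' γ ⇒ (α ∧' ¬' α)) ∷ (α ⇒ α , ∘' α ∨' (α ∧' ¬' α)) ∷ []
axiomRules cl  α β γ = (γ ⇔' (α ∧' ¬' α) , ¬' γ ⇒ ∘' α) ∷ (α ⇒ α , (α ∧' ¬' α) ∨' ∘' α) ∷ []
axiomRules cf  α β γ = (γ ⇔' ¬' α , ¬' γ ⇒ α) ∷ []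
axiomRules d1  α β γ = (α ⇒ α , ∘' α ∨' α) ∷ []
axiomRules d2  α β γ = (α ⇒ α , ∘' α ∨' ¬' α) ∷ []
axiomRules i1  α β γ = (γ ⇔' ∘' α , ¬' γ ⇒ α) ∷ (α ⇒ α , ∘' α ∨' α) ∷ []
axiomRules i2  α β γ = (γ ⇔' ∘' α , ¬' γ ⇒ ¬' α) ∷ (α ⇒ α , ∘' α ∨' ¬' α) ∷ []
axiomRules a∘  α β γ = (γ ⇔' ∘' α , ∘' γ) ∷ []
axiomRules a¬  α β γ = (γ ⇔' ¬' α , ∘' α ⇒ ∘' γ) ∷ []
axiomRules ca∧ α β γ = (γ ⇔' (α ∧' β) , (∘' α ∧' ∘' β) ⇒ ∘' γ) ∷ []
axiomRules ca∨ α β γ = (γ ⇔' (α ∨' β) , (∘' α ∧' ∘' β) ⇒ ∘' γ) ∷ []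
axiomRules ca⇒ α β γ = (γ ⇔' (α ⇒ β) , (∘' α ∧' ∘' β) ⇒ ∘' γ) ∷ []

rulesAt : Schema → Formula → Formula → Formula → List Rule
rulesAt Ax α β γ = (α ⇔' β , ¬' α ⇔' ¬' β) ∷ (α ⇔' β , ∘' α ⇔' ∘' β) ∷ axiomRules Ax α β γ

Admissible : Schema → Rule → Set
Admissible Ax (η , δ) = RmbC Ax η → RmbC Ax δ

-- A premise `α ⇒ α` makes a rule unconditional. In `ci`, `cl`, `i1` and `i2` such a rule records
-- `ζ ∨' χ`, which follows from the axiom `¬' ζ ⇒ χ` by `em`; it serves the case where the set of
-- `ζ` has no name and negation is the complement.
axiomRules-admissible : ∀ Ax α β γ → All (Admissible Ax) (axiomRules Ax α β γ)
axiomRules-admissible Ax α β γ = go Ax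
  where
  module D Ax = Derivability Ax

  ¬-rule : ∀ {Ax ζ χ} → RmbC Ax (¬' ζ ⇒ χ) → RmbC Ax (γ ⇔' ζ) → RmbC Ax (¬' γ ⇒ χ)
  ¬-rule {Ax} t e = D.⇒-trans Ax (D.⇔-to Ax (R¬ e)) t

  ∘-rule : ∀ {Ax ζ χ} → RmbC Ax (χ ⇒ ∘' ζ) → RmbC Ax (γ ⇔' ζ) → RmbC Ax (χ ⇒ ∘' γ)
  ∘-rule {Ax} t e = D.⇒-trans Ax t (D.⇔-from Ax (R∘ e))

  ∨-rule : ∀ {Ax ζ χ} → RmbC Ax (¬' ζ ⇒ χ) → RmbC Ax (ζ ∨' χ)
  ∨-rule {Ax} t = D.em-elim Ax (∨I₁ _ _) (D.⇒-trans Ax t (∨I₂ _ _))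

  go : ∀ Ax → All (Admissible Ax) (axiomRules Ax α β γ)
  go ciw = (λ _ → extra (ciw α)) ∷ []
  go ci  = ¬-rule (extra (ci α)) ∷ (λ _ → ∨-rule (extra (ci α))) ∷ []
  go cl  = ¬-rule (extra (cl α)) ∷ (λ _ → ∨-rule (extra (cl α))) ∷ []
  go cf  = ¬-rule (extra (cf α)) ∷ []
  go d1  = (λ _ → extra (d1 α)) ∷ []
  go d2  = (λ _ → extra (d2 α)) ∷ []
  go i1  = ¬-rule (extra (i1 α)) ∷ (λ _ → ∨-rule (extra (i1 α))) ∷ []
  go i2  = ¬-rule (extra (i2 α)) ∷ (λ _ → ∨-rule (extra (i2 α))) ∷ []
  go a∘  = (λ e → MP (extra (a∘ α)) (D.⇔-from a∘ (R∘ e))) ∷ []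
  go a¬  = ∘-rule (extra (a¬ α)) ∷ []
  go ca∧ = ∘-rule (extra (ca∧ α β)) ∷ []
  go ca∨ = ∘-rule (extra (ca∨ α β)) ∷ []
  go ca⇒ = ∘-rule (extra (ca⇒ α β)) ∷ []

rules : Schema → List Formula → List Rule
rules Ax F = concatMap (λ (α , β , γ) → rulesAt Ax α β γ) (cartesianProduct F (cartesianProduct F F))

rules-admissible : ∀ Ax F → All (Admissible Ax) (rules Ax F)
rules-admissible Ax F = All.concat⁺ (All.map⁺ (All.universal (λ (α , β , γ) →
  R¬ ∷ R∘ ∷ axiomRules-admissible Ax α β γ) (cartesianProduct F (cartesianProduct F F))))

rulesAt⊆rules : ∀ {Ax F α β γ} → α ∈ F → β ∈ F → γ ∈ F → rulesAt Ax α β γ ⊆ rules Ax F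
rulesAt⊆rules i j k r = ∈-concatMap⁺ _ (lose (∈-cartesianProduct⁺ i (∈-cartesianProduct⁺ j k)) r)

-- Elimination of worlds.

Respects : List World → Rule → Set
Respects W (η , δ) = W ⊨ η → W ⊨ δ

respects? : ∀ W → Decidable (Respects W)
respects? W (η , δ) = W ⊨? η →-dec W ⊨? δ

-- Filtering W by a derivable δ keeps it complete: truth of γ in the filtered list is truth of δ ⇒ γ in W.
module Saturation (Ax : Schema) (R : List Rule) (admissible : All (Admissible Ax) R) (A : List Formula)
                  (atoms⊆ : ∀ {η δ} → (η , δ) ∈ R → atoms η ⊆ A × atoms δ ⊆ A) where

  Complete : List World → Set
  Complete W = ∀ γ → atoms γ ⊆ A → W ⊨ γ → RmbC Ax γ

  restrict : Formula → List World → List World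
  restrict δ = filter (λ w → eval w δ Bool.≟ true)

  restrict-complete : ∀ {W δ} → atoms δ ⊆ A → RmbC Ax δ → Complete W → Complete (restrict δ W)
  restrict-complete {W} {δ} sδ t c γ sγ v = MP t (c (δ ⇒ γ) (++⊆ sδ sγ) (All.tabulate λ w∈ →
      imp-intro λ e → All.lookup v (∈-filter⁺ (λ w → eval w δ Bool.≟ true) w∈ e)))
    where
    ++⊆ : ∀ {xs ys zs : List Formula} → xs ⊆ zs → ys ⊆ zs → xs ++ ys ⊆ zs
    ++⊆ {xs} f g = [ f , g ]′ ∘ ∈-++⁻ xs

  -- A violated rule has a premise true throughout `W`, hence derivable by completeness, so its
  -- conclusion is derivable by admissibility. Some world refutes that conclusion, so restricting to
  -- it shortens the list.
  saturate : ∀ W → Acc ℕ._<_ (length W) → Complete W → ∃[ V ] Complete V × All (Respects V) R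
  saturate W (acc rec) c with All.all? (respects? W) R
  ... | yes r = W , c , r
  ... | no ¬r with find (All.¬All⇒Any¬ (respects? W) R ¬r)
  ... | (η , δ) , i , ¬i with W ⊨? η | W ⊨? δ
  ... | no ¬η | _      = contradiction (λ h → contradiction h ¬η) ¬i
  ... | yes _ | yes hδ = contradiction (λ _ → hδ) ¬i
  ... | yes h | no ¬δ  =
    saturate (restrict δ W)
      (rec (filter-notAll _ W (All.¬All⇒Any¬ (λ w → eval w δ Bool.≟ true) W ¬δ)))
      (restrict-complete (proj₂ (atoms⊆ i)) (All.lookup admissible i (c η (proj₁ (atoms⊆ i)) h)) c)

-- Subformulas and the finite Boolean closure.

subformulas : Formula → List Formula
subformulas (var n)  = var n ∷ []
subformulas (α ∧' β) = α ∧' β ∷ subformulas α ++ subformulas β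
subformulas (α ∨' β) = α ∨' β ∷ subformulas α ++ subformulas β
subformulas (α ⇒ β)  = (α ⇒ β) ∷ subformulas α ++ subformulas β
subformulas (¬' α)   = ¬' α ∷ subformulas α
subformulas (∘' α)   = ∘' α ∷ subformulas α

self∈subformulas : ∀ α → α ∈ subformulas α
self∈subformulas (var _)  = here refl
self∈subformulas (_ ∧' _) = here refl
self∈subformulas (_ ∨' _) = here refl
self∈subformulas (_ ⇒ _)  = here refl
self∈subformulas (¬' _)   = here refl
self∈subformulas (∘' _)   = here refl

ifThenElse : Formula → Formula → Formula → Formula
ifThenElse σ α β = (σ ∧' α) ∨' (∼ σ ∧' β)

-- Full decision trees testing the members of `Θ` in order, with constant leaves: by Shannon
-- expansion they represent every Boolean function of the values of `Θ`.
booleanClosure : List Formula → List Formula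
booleanClosure []      = ⊥' ∷ ∼ ⊥' ∷ []
booleanClosure (σ ∷ Θ) = cartesianProductWith (ifThenElse σ) (booleanClosure Θ) (booleanClosure Θ)

Property : Set
Property = World → Bool

‖_‖ : Formula → Property
‖ α ‖ w = eval w α

infix 4 _≗ʷ_

_≗ʷ_ : Property → Property → Set
X ≗ʷ Y = ∀ w → X w ≡ Y w

-- Agreement is demanded at every world, so the notion does not depend on the surviving list, which
-- is computed only after the closure is fixed.
record Definable (Θ : List Formula) (X : Property) : Set where
  constructor defined
  field
    formula  : Formula
    ∈closure : formula ∈ booleanClosure Θ
    defines  : ‖ formula ‖ ≗ʷ X

eval-ifThenElse : ∀ w σ α β → eval w (ifThenElse σ α β) ≡ (if eval w σ then eval w α else eval w β)
eval-ifThenElse w σ α β rewrite eval-⊥' w with eval w σ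
... | true  = Bool.∨-identityʳ _
... | false = refl

definable-if : ∀ {σ Θ X Y} → Definable Θ X → Definable Θ Y →
               Definable (σ ∷ Θ) (λ w → if eval w σ then X w else Y w)
definable-if {σ} (defined α i e) (defined β j f) =
  defined (ifThenElse σ α β) (∈-cartesianProductWith⁺ (ifThenElse σ) i j)
    λ w → trans (eval-ifThenElse w σ α β) (cong₂ (if eval w σ then_else_) (e w) (f w))

definable-≗ : ∀ {Θ X Y} → Definable Θ X → X ≗ʷ Y → Definable Θ Y
definable-≗ (defined α i e) f = defined α i λ w → trans (e w) (f w)

definable-const : ∀ Θ b → Definable Θ (const b)
definable-const []      false = defined ⊥' (here refl) eval-⊥'
definable-const []      true  = defined (∼ ⊥') (there (here refl)) λ w → cong (λ b → not b ∨ b) (eval-⊥' w)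
definable-const (σ ∷ Θ) b     =
  definable-≗ (definable-if (definable-const Θ b) (definable-const Θ b)) (λ w → Bool.if-eta (eval w σ))

definable-∈ : ∀ {Θ σ} → σ ∈ Θ → Definable Θ ‖ σ ‖
definable-∈ {σ ∷ Θ} (here refl) =
  definable-≗ (definable-if (definable-const Θ true) (definable-const Θ false)) (λ w → if-η (eval w σ))
  where
  if-η : ∀ c → (if c then true else false) ≡ c
  if-η true  = refl
  if-η false = refl
definable-∈ {τ ∷ Θ} {σ} (there i) =
  definable-≗ (definable-if (definable-∈ i) (definable-∈ i)) (λ w → Bool.if-eta (eval w τ))

booleanClosure-[] : ∀ {α} → α ∈ booleanClosure [] → ∃[ b ] ‖ α ‖ ≗ʷ const b
booleanClosure-[] (here refl)         = false , eval-⊥'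
booleanClosure-[] (there (here refl)) = true , λ w → cong (λ b → not b ∨ b) (eval-⊥' w)

-- Both trees test the same formulas in the same order, so the operation passes through the tests
-- down to the constant leaves.
definable-op : ∀ (_∙_ : Bool → Bool → Bool) Θ {X Y} →
               Definable Θ X → Definable Θ Y → Definable Θ (λ w → X w ∙ Y w)
definable-op _∙_ Θ (defined α i e) (defined β j f) = definable-≗ (op Θ i j) (λ w → cong₂ _∙_ (e w) (f w))
  where
  op : ∀ Θ {α β} → α ∈ booleanClosure Θ → β ∈ booleanClosure Θ → Definable Θ (λ w → eval w α ∙ eval w β)
  op [] i j with booleanClosure-[] i | booleanClosure-[] j
  ... | b , e | c , f = definable-≗ (definable-const [] (b ∙ c)) (λ w → sym (cong₂ _∙_ (e w) (f w)))
  op (σ ∷ Θ) i j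
    with ∈-cartesianProductWith⁻ (ifThenElse σ) (booleanClosure Θ) (booleanClosure Θ) i
       | ∈-cartesianProductWith⁻ (ifThenElse σ) (booleanClosure Θ) (booleanClosure Θ) j
  ... | α₁ , α₂ , i₁ , i₂ , refl | β₁ , β₂ , j₁ , j₂ , refl =
    definable-≗ (definable-if (op Θ i₁ j₁) (op Θ i₂ j₂)) λ w → trans (if-op (eval w σ))
      (sym (cong₂ _∙_ (eval-ifThenElse w σ α₁ α₂) (eval-ifThenElse w σ β₁ β₂)))
    where
    if-op : ∀ c {a b a′ b′} → (if c then a ∙ b else (a′ ∙ b′)) ≡ (if c then a else a′) ∙ (if c then b else b′)
    if-op true  = refl
    if-op false = refl

-- Extension of negation and consistency to all sets of worlds.

-- Where the operators are not forced, ¬ is the classical complement; the value chosen for ∘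
-- is what makes the axiom hold there.
default : Schema → Bool → Bool
default i2  b = b
default ca∧ b = false
default ca∨ b = false
default ca⇒ b = false
default _   b = true

-- The algebra of properties of worlds in W, up to pointwise equality on W.
module Algebra (Ax : Schema) (Θ : List Formula) (⊥'⊆Θ : subformulas ⊥' ⊆ Θ) (W : List World)
               (closed : All (Respects W) (rules Ax (Θ ++ booleanClosure Θ))) where

  F : List Formula
  F = Θ ++ booleanClosure Θ

  infix 4 _≈_

  _≈_ : Property → Property → Set
  X ≈ Y = All (λ w → X w ≡ Y w) W

  ≈-sym : ∀ {X Y} → X ≈ Y → Y ≈ X
  ≈-sym = All.map sym

  ≈-trans : ∀ {X Y Z} → X ≈ Y → Y ≈ Z → X ≈ Z
  ≈-trans e f = All.zipWith (uncurry trans) (e , f)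

  ⇔-intro : ∀ {α β} → ‖ α ‖ ≈ ‖ β ‖ → W ⊨ α ⇔' β
  ⇔-intro = All.map iff-intro

  ⇔-elim : ∀ {α β} → W ⊨ α ⇔' β → ‖ α ‖ ≈ ‖ β ‖
  ⇔-elim = All.map iff-elim

  Named : Property → Set
  Named X = ∃[ α ] α ∈ F × X ≈ ‖ α ‖

  named? : ∀ X → Dec (Named X)
  named? X = map′ find (λ (α , i , e) → lose i e)
    (Any.any? (λ α → All.all? (λ w → X w Bool.≟ eval w α) W) F)

  named-≈ : ∀ {X Y} → X ≈ Y → Named X → Named Y
  named-≈ e (α , i , f) = α , i , ≈-trans (≈-sym e) f

  named-op : ∀ (_∙_ : Bool → Bool → Bool) {X Y} → Named X → Named Y → Named (λ w → X w ∙ Y w)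
  named-op _∙_ (α , i , e) (β , j , f) with definable-op _∙_ Θ (definable i) (definable j)
    where
    definable : ∀ {γ} → γ ∈ F → Definable Θ ‖ γ ‖
    definable {γ} k = [ definable-∈ , (λ l → defined γ l λ _ → refl) ]′ (∈-++⁻ Θ k)
  ... | defined γ k g = γ , ∈-++⁺ʳ Θ k , All.zipWith (λ {w} (a , b) → trans (cong₂ _∙_ a b) (sym (g w))) (e , f)

  ⊥'∈F : ⊥' ∈ F
  ⊥'∈F = ∈-++⁺ˡ (⊥'⊆Θ (here refl))

  named-not : ∀ {X} → Named X → Named (not ∘ X)
  named-not d = named-op (λ b _ → not b) d d

  ¬named-not : ∀ {X} → ¬ Named X → ¬ Named (not ∘ X)
  ¬named-not {X} ¬d d =
    ¬d (named-≈ (All.tabulate (λ {w} _ → Bool.not-involutive (X w))) (named-not d))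

  rule : ∀ {α β γ η δ} → α ∈ F → β ∈ F → γ ∈ F → (η , δ) ∈ rulesAt Ax α β γ → W ⊨ η → W ⊨ δ
  rule i j k r = All.lookup closed (rulesAt⊆rules i j k r)

  ¬-cong : ∀ {α β} → α ∈ F → β ∈ F → ‖ α ‖ ≈ ‖ β ‖ → ‖ ¬' α ‖ ≈ ‖ ¬' β ‖
  ¬-cong {α} {β} i j e = ⇔-elim {¬' α} {¬' β} (rule i j j (here refl) (⇔-intro {α} {β} e))

  ∘-cong : ∀ {α β} → α ∈ F → β ∈ F → ‖ α ‖ ≈ ‖ β ‖ → ‖ ∘' α ‖ ≈ ‖ ∘' β ‖
  ∘-cong {α} {β} i j e = ⇔-elim {∘' α} {∘' β} (rule i j j (there (here refl)) (⇔-intro {α} {β} e))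

  -- The search may return any name of `X`; `¬-cong` and `∘-cong` make the choice immaterial on `W`.
  neg cons : Property → Property
  neg X with named? X
  ... | yes (α , _) = ‖ ¬' α ‖
  ... | no _        = not ∘ X
  cons X with named? X
  ... | yes (α , _) = ‖ ∘' α ‖
  ... | no _        = default Ax ∘ X

  neg-named : ∀ {X α} → α ∈ F → X ≈ ‖ α ‖ → neg X ≈ ‖ ¬' α ‖
  neg-named {X} {α} i e with named? X
  ... | yes (β , j , f) = ¬-cong {β} {α} j i (≈-trans (≈-sym f) e)
  ... | no ¬d           = contradiction (α , i , e) ¬d

  cons-named : ∀ {X α} → α ∈ F → X ≈ ‖ α ‖ → cons X ≈ ‖ ∘' α ‖
  cons-named {X} {α} i e with named? X
  ... | yes (β , j , f) = ∘-cong {β} {α} j i (≈-trans (≈-sym f) e)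
  ... | no ¬d           = contradiction (α , i , e) ¬d

  neg-unnamed : ∀ {X} → ¬ Named X → ∀ w → neg X w ≡ not (X w)
  neg-unnamed {X} ¬d w with named? X
  ... | yes d = contradiction d ¬d
  ... | no _  = refl

  cons-unnamed : ∀ {X} → ¬ Named X → ∀ w → cons X w ≡ default Ax (X w)
  cons-unnamed {X} ¬d w with named? X
  ... | yes d = contradiction d ¬d
  ... | no _  = refl

  neg-cong : ∀ {X Y} → X ≈ Y → neg X ≈ neg Y
  neg-cong {X} {Y} e with named? X
  ... | yes (α , i , f) = ≈-sym (neg-named i (≈-trans (≈-sym e) f))
  ... | no ¬d = All.map (λ {w} x → trans (cong not x) (sym (neg-unnamed (¬d ∘ named-≈ (≈-sym e)) w))) e

  cons-cong : ∀ {X Y} → X ≈ Y → cons X ≈ cons Y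
  cons-cong {X} {Y} e with named? X
  ... | yes (α , i , f) = ≈-sym (cons-named i (≈-trans (≈-sym e) f))
  ... | no ¬d = All.map (λ {w} x → trans (cong (default Ax) x) (sym (cons-unnamed (¬d ∘ named-≈ (≈-sym e)) w))) e

  value : Formula → Property
  value (var n)  w = eval w (var n)
  value (α ∧' β) w = value α w ∧ value β w
  value (α ∨' β) w = value α w ∨ value β w
  value (α ⇒ β)  w = not (value α w) ∨ value β w
  value (¬' α)     = neg (value α)
  value (∘' α)     = cons (value α)

  -- The filtration lemma: `eval` treats `¬' α` and `∘' α` as atoms up to truncation, while `value`
  -- computes them by the operators. They agree because `α` lies in `Θ` and so names its own set.
  truth : ∀ α → subformulas α ⊆ Θ → value α ≈ ‖ α ‖
  truth (var n)  s = All.tabulate (λ _ → refl)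
  truth (α ∧' β) s = All.zipWith (uncurry (cong₂ _∧_))
    (truth α (s ∘ there ∘ ∈-++⁺ˡ) , truth β (s ∘ there ∘ ∈-++⁺ʳ _))
  truth (α ∨' β) s = All.zipWith (uncurry (cong₂ _∨_))
    (truth α (s ∘ there ∘ ∈-++⁺ˡ) , truth β (s ∘ there ∘ ∈-++⁺ʳ _))
  truth (α ⇒ β)  s = All.zipWith (uncurry (cong₂ (λ a b → not a ∨ b)))
    (truth α (s ∘ there ∘ ∈-++⁺ˡ) , truth β (s ∘ there ∘ ∈-++⁺ʳ _))
  truth (¬' α)   s = neg-named (∈-++⁺ˡ (s (there (self∈subformulas α)))) (truth α (s ∘ there))
  truth (∘' α)   s = cons-named (∈-++⁺ˡ (s (there (self∈subformulas α)))) (truth α (s ∘ there))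

  -- Tools for validity in the algebra.

  -- Splitting through a function leaves the occurrences of `neg` and `cons` in the goal folded, so
  -- the lemmas on named and unnamed sets apply to them.
  by-name : ∀ {P : Set} X → (∀ α → α ∈ F → X ≈ ‖ α ‖ → P) → (¬ Named X → P) → P
  by-name X f g with named? X
  ... | yes (α , i , e) = f α i e
  ... | no ¬d           = g ¬d

  Valid : Property → Set
  Valid X = X ≈ const true

  ⊨-refl : ∀ α → W ⊨ α ⇒ α
  ⊨-refl α = All.tabulate λ {w} _ → imp-intro {eval w α} id

  table₃ : ∀ (f : Bool → Bool → Bool → Bool) → allBool (λ a → allBool λ b → allBool λ c → f a b c) ≡ true →
           ∀ (X Y Z : Property) → Valid (λ w → f (X w) (Y w) (Z w))
  table₃ f t X Y Z = All.tabulate λ {w} _ → 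
    allBool-elim (f (X w) (Y w))
      (allBool-elim (λ b → allBool (f (X w) b)) (allBool-elim (λ a → allBool λ b → allBool (f a b)) t (X w)) (Y w))
      (Z w)

  neg-valid : ∀ X → Valid (λ w → X w ∨ neg X w)
  neg-valid X = by-name X
    (λ α i e → All.zipWith
      (λ {w} (a , b) → trans (cong₂ _∨_ a b) (∨-not-∨ (eval w α) (bit w (¬' α)))) (e , neg-named i e))
    (λ ¬d → All.tabulate λ {w} _ → trans (cong (X w ∨_) (neg-unnamed ¬d w)) (Bool.∨-inverseʳ (X w)))
    where
    ∨-not-∨ : ∀ x y → x ∨ (not x ∨ y) ≡ true
    ∨-not-∨ true  y = refl
    ∨-not-∨ false y = refl

  -- On named sets truncation excludes that `X`, its negation and its consistency hold together. On
  -- unnamed sets negation is the complement, so the value of `cons` is irrelevant.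
  cons-valid : ∀ X (Y : Property) → Valid (λ w → not (cons X w) ∨ (not (X w) ∨ (not (neg X w) ∨ Y w)))
  cons-valid X Y = by-name X
    (λ α i e → All.tabulate λ {w} m → trans
      (cong₂ (λ c d → not c ∨ d) (All.lookup (cons-named i e) m)
        (cong₂ (λ a b → not a ∨ (not b ∨ Y w)) (All.lookup e m) (All.lookup (neg-named i e) m)))
      (consistent (eval w α) (bit w (¬' α)) (bit w (∘' α)) (Y w)))
    (λ ¬d → All.tabulate λ {w} _ → trans
      (cong (λ b → not (cons X w) ∨ (not (X w) ∨ (not b ∨ Y w))) (neg-unnamed ¬d w))
      (classical (X w) (cons X w) (Y w)))
    where
    consistent : ∀ x b c y → not (not (x ∧ b) ∧ c) ∨ (not x ∨ (not (not x ∨ b) ∨ y)) ≡ true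
    consistent false b     c y = Bool.∨-zeroʳ (not c)
    consistent true  false c y = Bool.∨-zeroʳ (not c)
    consistent true  true  c y = refl

    classical : ∀ x c y → not c ∨ (not x ∨ (not (not x) ∨ y)) ≡ true
    classical false c y = Bool.∨-zeroʳ (not c)
    classical true  c y = Bool.∨-zeroʳ (not c)

  -- Here `ζ` is a compound such as `∘' β` that may lie outside `F`. If its set has a name `γ`, the
  -- rule for `γ` gives the bound; otherwise `neg Z` is the complement of `ζ`, and `ζ ∨' χ`
  -- suffices.
  neg-bound : ∀ {Z} ζ χ → Z ≈ ‖ ζ ‖ → W ⊨ ζ ∨' χ →
              (∀ γ → γ ∈ F → W ⊨ γ ⇔' ζ → W ⊨ ¬' γ ⇒ χ) →
              Valid (λ w → not (neg Z w) ∨ eval w χ)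
  neg-bound {Z} ζ χ e v r = by-name Z
    (λ γ k f → All.zipWith (λ {w} (a , b) → trans (cong (λ b → not b ∨ eval w χ) a) b)
      (neg-named k f , r γ k (⇔-intro {γ} {ζ} (≈-trans (≈-sym f) e))))
    (λ ¬d → All.zipWith (λ {w} (a , b) → trans
      (cong (_∨ eval w χ) (trans (cong not (neg-unnamed ¬d w)) (trans (Bool.not-involutive (Z w)) a))) b) (e , v))

  cons-bound : ∀ {Z} ζ κ → Z ≈ ‖ ζ ‖ → (¬ Named Z → Valid (cons Z)) →
               (∀ γ → γ ∈ F → W ⊨ γ ⇔' ζ → W ⊨ κ ⇒ ∘' γ) →
               Valid (λ w → not (eval w κ) ∨ cons Z w)
  cons-bound {Z} ζ κ e v r = by-name Z
    (λ γ k f → All.zipWith (λ {w} (a , b) → trans (cong (not (eval w κ) ∨_) a) b)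
      (cons-named k f , r γ k (⇔-intro {γ} {ζ} (≈-trans (≈-sym f) e))))
    (λ ¬d → All.map (λ {w} a → trans (cong (not (eval w κ) ∨_) a) (Bool.∨-zeroʳ (not (eval w κ)))) (v ¬d))

  -- With χ contradictory, ‖∘⊥'‖ is all of W, so the bound for ¬∘⊥' applies to the top element.
  neg-top : ∀ {Z} χ → (∀ w → eval w χ ≡ false) → W ⊨ ∘' ⊥' ∨' χ →
            (∀ γ → γ ∈ F → W ⊨ γ ⇔' ∘' ⊥' → W ⊨ ¬' γ ⇒ χ) →
            Valid Z → neg Z ≈ const false
  neg-top {Z} χ f v r z = All.map (λ {w} → to-false (f w)) (neg-bound (∘' ⊥') χ top v r)
    where
    to-false : ∀ {x y} → y ≡ false → not x ∨ y ≡ true → x ≡ false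
    to-false {false} _ _ = refl
    to-false {true} refl ()

    top : Z ≈ ‖ ∘' ⊥' ‖
    top = All.zipWith (λ {w} (a , b) →
      trans a (trans (sym b) (trans (cong (eval w (∘' ⊥') ∨_) (f w)) (Bool.∨-identityʳ (eval w (∘' ⊥')))))) (z , v)

  -- If `X` or `Y` is unnamed, its consistency is empty and the implication is vacuous. If both are
  -- named, so is their combination, and the rule applies to its name.
  conjoined : ∀ (_∙_ : Bool → Bool → Bool) (_#_ : Formula → Formula → Formula) →
              (∀ α β w → eval w (α # β) ≡ eval w α ∙ eval w β) →
              (∀ b → default Ax b ≡ false) →
              (∀ {α β γ} → α ∈ F → β ∈ F → γ ∈ F → W ⊨ γ ⇔' (α # β) → W ⊨ (∘' α ∧' ∘' β) ⇒ ∘' γ) →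
              ∀ X Y → Valid (λ w → not (cons X w ∧ cons Y w) ∨ cons (λ v → X v ∙ Y v) w)
  conjoined _∙_ _#_ eval-# default-false r X Y = by-name X
    (λ α i e → by-name Y (λ β j f → both α i e β j f)
      (λ ¬d → All.tabulate λ {w} _ → vacuous (cons X w) _ (inj₂ (undefined ¬d w))))
    (λ ¬d → All.tabulate λ {w} _ → vacuous _ (cons Y w) (inj₁ (undefined ¬d w)))
    where
    Z : Property
    Z w = X w ∙ Y w

    undefined : ∀ {X} → ¬ Named X → ∀ w → cons X w ≡ false
    undefined ¬d w = trans (cons-unnamed ¬d w) (default-false _)

    vacuous : ∀ x y {z} → x ≡ false ⊎ y ≡ false → not (x ∧ y) ∨ z ≡ true
    vacuous false y     _           = refl
    vacuous true  false _           = refl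
    vacuous true  true  (inj₁ ())
    vacuous true  true  (inj₂ ())

    both : ∀ α → α ∈ F → X ≈ ‖ α ‖ → ∀ β → β ∈ F → Y ≈ ‖ β ‖ → Valid (λ w → not (cons X w ∧ cons Y w) ∨ cons Z w)
    both α i e β j f = All.tabulate λ {w} m → trans
      (cong (λ b → not b ∨ cons Z w)
        (cong₂ _∧_ (All.lookup (cons-named i e) m) (All.lookup (cons-named j f) m)))
      (All.lookup (cons-bound (α # β) (∘' α ∧' ∘' β) Z≈
        (λ ¬d → contradiction (named-op _∙_ (α , i , e) (β , j , f)) ¬d)
        (λ γ k → r i j k)) m)
      where
      Z≈ : Z ≈ ‖ α # β ‖
      Z≈ = All.zipWith (λ {w} (a , b) → trans (cong₂ _∙_ a b) (sym (eval-# α β w))) (e , f)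

  -- Validity of the axioms and soundness.

  -- For a named set the matching rule is invoked, two `there`s skipping the congruence rules in
  -- `rulesAt`; for an unnamed one `default` decides.
  valid : ∀ {ψ} → Instance Ax ψ → Valid (value ψ)
  valid (ciw α) = by-name (value α)
    (λ β i e → All.tabulate λ m → trans
      (cong₂ _∨_ (All.lookup (cons-named i e) m) (cong₂ _∧_ (All.lookup e m) (All.lookup (neg-named i e) m)))
      (All.lookup (rule i i i (there (there (here refl))) (⊨-refl β)) m))
    (λ ¬d → All.tabulate λ {w} _ → cong (_∨ (value α w ∧ neg (value α) w)) (cons-unnamed ¬d w))
  valid (d1 α) = by-name (value α)
    (λ β i e → All.tabulate λ m → trans
      (cong₂ _∨_ (All.lookup (cons-named i e) m) (All.lookup e m))
      (All.lookup (rule i i i (there (there (here refl))) (⊨-refl β)) m))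
    (λ ¬d → All.tabulate λ {w} _ → cong (_∨ value α w) (cons-unnamed ¬d w))
  valid (d2 α) = by-name (value α)
    (λ β i e → All.tabulate λ m → trans
      (cong₂ _∨_ (All.lookup (cons-named i e) m) (All.lookup (neg-named i e) m))
      (All.lookup (rule i i i (there (there (here refl))) (⊨-refl β)) m))
    (λ ¬d → All.tabulate λ {w} _ → cong (_∨ neg (value α) w) (cons-unnamed ¬d w))
  valid (ci α) = by-name (value α)
    (λ β i e → All.tabulate λ {w} m → trans
      (cong (not (neg (cons (value α)) w) ∨_) (cong₂ _∧_ (All.lookup e m) (All.lookup (neg-named i e) m)))
      (All.lookup (neg-bound (∘' β) (β ∧' ¬' β) (cons-named i e) (weak β i) (strong β i)) m))
    -- `∘` of an unnamed set is all of `W`, whose negation is empty by `neg-top`, so the antecedent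
    -- fails.
    (λ ¬d → All.map (λ {w} e → cong (λ b → not b ∨ (value α w ∧ neg (value α) w)) e)
      (neg-top (⊥' ∧' ¬' ⊥') (λ w → cong (_∧ eval w (¬' ⊥')) (eval-⊥' w)) (weak ⊥' ⊥'∈F) (strong ⊥' ⊥'∈F)
        (All.tabulate λ {w} _ → cons-unnamed ¬d w)))
    where
    weak : ∀ β → β ∈ F → W ⊨ ∘' β ∨' (β ∧' ¬' β)
    weak β i = rule i i i (there (there (there (here refl)))) (⊨-refl β)

    strong : ∀ β → β ∈ F → ∀ γ → γ ∈ F → W ⊨ γ ⇔' ∘' β → W ⊨ ¬' γ ⇒ (β ∧' ¬' β)
    strong β i γ k = rule i i k (there (there (here refl)))
  valid (i1 α) = by-name (value α)
    (λ β i e → All.tabulate λ {w} m → trans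
      (cong (not (neg (cons (value α)) w) ∨_) (All.lookup e m))
      (All.lookup (neg-bound (∘' β) β (cons-named i e) (weak β i) (strong β i)) m))
    (λ ¬d → All.map (λ {w} e → cong (λ b → not b ∨ value α w) e)
      (neg-top ⊥' eval-⊥' (weak ⊥' ⊥'∈F) (strong ⊥' ⊥'∈F) (All.tabulate λ {w} _ → cons-unnamed ¬d w)))
    where
    weak : ∀ β → β ∈ F → W ⊨ ∘' β ∨' β
    weak β i = rule i i i (there (there (there (here refl)))) (⊨-refl β)

    strong : ∀ β → β ∈ F → ∀ γ → γ ∈ F → W ⊨ γ ⇔' ∘' β → W ⊨ ¬' γ ⇒ β
    strong β i γ k = rule i i k (there (there (here refl)))
  valid (i2 α) = by-name (value α)
    (λ β i e → All.tabulate λ {w} m → trans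
      (cong (not (neg (cons (value α)) w) ∨_) (All.lookup (neg-named i e) m))
      (All.lookup (neg-bound (∘' β) (¬' β) (cons-named i e)
        (rule i i i (there (there (there (here refl)))) (⊨-refl β))
        (λ γ k → rule i i k (there (there (here refl))))) m))
    -- With `default i2` the identity, `∘` fixes an unnamed set and the axiom becomes an instance of
    -- `x ⇒ x`.
    (λ ¬d → All.map (λ {w} e → trans (cong (λ b → not b ∨ neg (value α) w) e) (imp-intro {neg (value α) w} id))
      (neg-cong (All.tabulate λ {w} _ → cons-unnamed ¬d w)))
  valid (cl α) = by-name (value α)
    (λ β i e → All.tabulate λ {w} m → trans
      (cong (not (neg (value (α ∧' ¬' α)) w) ∨_) (All.lookup (cons-named i e) m))
      (All.lookup (neg-bound (β ∧' ¬' β) (∘' β) (All.zipWith (uncurry (cong₂ _∧_)) (e , neg-named i e))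
        (rule i i i (there (there (there (here refl)))) (⊨-refl β))
        (λ γ k → rule i i k (there (there (here refl))))) m))
    (λ ¬d → All.tabulate λ {w} _ → trans
      (cong (not (neg (value (α ∧' ¬' α)) w) ∨_) (cons-unnamed ¬d w))
      (Bool.∨-zeroʳ (not (neg (value (α ∧' ¬' α)) w))))
  valid (cf α) = by-name (value α)
    (λ β i e → All.tabulate λ {w} m → trans
      (cong (not (neg (neg (value α)) w) ∨_) (All.lookup e m))
      (All.lookup (neg-bound (¬' β) β (neg-named i e)
        -- The disjunction needed by `neg-bound` is `¬' β ∨' β`, true at every world by truncation.
        (All.tabulate λ {w} _ → not-∨-∨ (eval w β) (bit w (¬' β)))
        (λ γ k → rule i i k (there (there (here refl))))) m))
    -- The complement of an unnamed set is unnamed, so double negation is double complement.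
    (λ ¬d → All.map (λ {w} e → trans
        (cong (λ b → not b ∨ value α w) (trans e (neg-unnamed (¬named-not ¬d) w))) (triple-not (value α w)))
      (neg-cong (All.tabulate λ {w} _ → neg-unnamed ¬d w)))
    where
    not-∨-∨ : ∀ x y → (not x ∨ y) ∨ x ≡ true
    not-∨-∨ true  y = Bool.∨-zeroʳ y
    not-∨-∨ false y = refl

    triple-not : ∀ x → not (not (not x)) ∨ x ≡ true
    triple-not true  = refl
    triple-not false = refl
  valid (a∘ α) = by-name (value α)
    (λ β i e → iterated β i (cons-named i e))
    -- `∘` of an unnamed set is all of `W`, and so is the set of `∘' (∘' p)`; this reduces the claim
    -- to a set of the form `∘' β` with `β` in `F`.
    (λ ¬d → iterated (∘' p) ∘p∈F
      (≈-trans (All.tabulate λ {w} _ → cons-unnamed ¬d w)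
        (≈-trans (≈-sym (iterated p p∈F ≈-refl)) (cons-named ∘p∈F ≈-refl))))
    where
    p∈F : p ∈ F
    p∈F = ∈-++⁺ˡ (⊥'⊆Θ (there (here refl)))

    ∘p∈F : ∘' p ∈ F
    ∘p∈F = ∈-++⁺ˡ (⊥'⊆Θ (there (there (there (there (there (here refl)))))))

    ≈-refl : ∀ {X} → X ≈ X
    ≈-refl = All.tabulate λ _ → refl

    iterated : ∀ β → β ∈ F → ∀ {Z} → Z ≈ ‖ ∘' β ‖ → Valid (cons Z)
    iterated β i {Z} e = by-name Z
      (λ γ k f → ≈-trans (cons-named k f)
        (rule i i k (there (there (here refl))) (⇔-intro {γ} {∘' β} (≈-trans (≈-sym f) e))))
      (λ ¬d → All.tabulate λ {w} _ → cons-unnamed ¬d w)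
  valid (a¬ α) = by-name (value α)
    (λ β i e → All.tabulate λ {w} m → trans
      (cong (λ b → not b ∨ cons (neg (value α)) w) (All.lookup (cons-named i e) m))
      (All.lookup (cons-bound (¬' β) (∘' β) (neg-named i e)
        (λ ¬d → All.tabulate λ {w} _ → cons-unnamed ¬d w)
        (λ γ k → rule i i k (there (there (here refl))))) m))
    -- Here the negation is the complement, again unnamed, so its consistency is all of `W`.
    (λ ¬d → All.map (λ {w} e → trans
        (cong (not (cons (value α) w) ∨_) (trans e (cons-unnamed (¬named-not ¬d) w)))
        (Bool.∨-zeroʳ (not (cons (value α) w))))
      (cons-cong (All.tabulate λ {w} _ → neg-unnamed ¬d w)))
  valid (ca∧ α β) = conjoined _∧_ _∧'_ (λ _ _ _ → refl) (λ _ → refl)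
    (λ i j k → rule i j k (there (there (here refl)))) (value α) (value β)
  valid (ca∨ α β) = conjoined _∨_ _∨'_ (λ _ _ _ → refl) (λ _ → refl)
    (λ i j k → rule i j k (there (there (here refl)))) (value α) (value β)
  valid (ca⇒ α β) = conjoined (λ a b → not a ∨ b) _⇒_ (λ _ _ _ → refl) (λ _ → refl)
    (λ i j k → rule i j k (there (there (here refl)))) (value α) (value β)

  soundness : ∀ {γ} → RmbC Ax γ → Valid (value γ)
  soundness (K α β)   = table₃ (λ a b _ → not a ∨ (not b ∨ a)) refl (value α) (value β) (value α)
  soundness (S α β γ) =
    table₃ (λ a b c → not (not a ∨ (not b ∨ c)) ∨ (not (not a ∨ b) ∨ (not a ∨ c))) refl (value α) (value β) (value γ)
  soundness (∧I α β)  = table₃ (λ a b _ → not a ∨ (not b ∨ (a ∧ b))) refl (value α) (value β) (value α)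
  soundness (∧E₁ α β) = table₃ (λ a b _ → not (a ∧ b) ∨ a) refl (value α) (value β) (value α)
  soundness (∧E₂ α β) = table₃ (λ a b _ → not (a ∧ b) ∨ b) refl (value α) (value β) (value α)
  soundness (∨I₁ α β) = table₃ (λ a b _ → not a ∨ (a ∨ b)) refl (value α) (value β) (value α)
  soundness (∨I₂ α β) = table₃ (λ a b _ → not b ∨ (a ∨ b)) refl (value α) (value β) (value α)
  soundness (∨E α β γ) =
    table₃ (λ a b c → not (not a ∨ c) ∨ (not (not b ∨ c) ∨ (not (a ∨ b) ∨ c))) refl (value α) (value β) (value γ)
  soundness (⇒∨ α β)  = table₃ (λ a b _ → (not a ∨ b) ∨ a) refl (value α) (value β) (value α)
  soundness (em α)    = neg-valid (value α)
  soundness (bc α β)  = cons-valid (value α) (value β)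
  soundness (extra i) = valid i
  soundness (MP d e)  = All.zipWith (uncurry imp-elim) (soundness d , soundness e)
  soundness (R¬ d)    = All.map iff-intro (neg-cong (All.map iff-elim (soundness d)))
  soundness (R∘ d)    = All.map iff-intro (cons-cong (All.map iff-elim (soundness d)))

-- The decision procedure.

decideBy : ∀ Ax Θ φ → subformulas ⊥' ⊆ Θ → subformulas φ ⊆ Θ → Dec (RmbC Ax φ)
decideBy Ax Θ φ ⊥'⊆Θ φ⊆Θ = decide (saturate (worlds A) (<-wellFounded _) (completeness A))
  where
  open Derivability Ax using (completeness)

  F : List Formula
  F = Θ ++ booleanClosure Θ

  R : List Rule
  R = rules Ax F

  ruleAtoms : Rule → List Formula
  ruleAtoms (η , δ) = atoms η ++ atoms δ

  -- The atoms of `φ` let completeness yield a derivation of `φ`; those of the rules let saturation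
  -- apply it to every premise.
  A : List Formula
  A = atoms φ ++ concatMap ruleAtoms R

  atoms⊆A : ∀ {η δ} → (η , δ) ∈ R → atoms η ⊆ A × atoms δ ⊆ A
  atoms⊆A {η} {δ} i = in-A ∘ ∈-++⁺ˡ , in-A ∘ ∈-++⁺ʳ (atoms η)
    where
    in-A : atoms η ++ atoms δ ⊆ A
    in-A a = ∈-++⁺ʳ (atoms φ) (∈-concatMap⁺ ruleAtoms (lose i a))

  open Saturation Ax R (rules-admissible Ax F) A atoms⊆A

  decide : ∃[ W ] Complete W × All (Respects W) R → Dec (RmbC Ax φ)
  decide (W , complete , closed) = map′ (complete φ ∈-++⁺ˡ) true-in-W (W ⊨? φ)
    where
    open Algebra Ax Θ ⊥'⊆Θ W closed hiding (F)

    true-in-W : RmbC Ax φ → W ⊨ φ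
    true-in-W d = ≈-trans (≈-sym (truth φ φ⊆Θ)) (soundness d)

corollary5p11 : (Ax : Schema) → Decidable (RmbC Ax)
corollary5p11 Ax φ =
  -- The subformulas of `⊥'` put `⊥'`, `p` and `∘' p` into `F`, as the unnamed cases of `ci`, `i1`
  -- and `a∘` require.
  decideBy Ax (subformulas φ ++ subformulas ⊥') φ (xs⊆ys++xs _ (subformulas φ)) (xs⊆xs++ys (subformulas φ) _)
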